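{- As $n\to+\infty$, $\kappa_+(n)\leqslant 2n\log n\,(1+o(1))$; that is, there is a function $\varepsilon(n)\to0$ such that $\kappa_+(n)\le 2n\log n\,(1+\varepsilon(n))$ for all $n\ge2$.
   Context: Every integer $n\ge 1$ is assigned a finite rooted planar tree $t(n)$: $t(1)$ is the single-vertex tree; if $n=p_1^{a_1}\cdots p_s^{a_s}$ with primes $p_1<\dots<p_s$ and $a_i\ge1$, then $t(n)$ consists of a root with $s$ edges to children, ordered left to right, the $i$-th edge leading to a copy of $t(a_i)$ rooted at that child. For $n\ge1$, $K\ge0$, the observable $O(n,\ldots,n+K)$ occurs at $m\ge1$ if $t(m+j)=t(n+j)$ for all $0\le j\le K$. $\kappa_+(n)$ is the least natural number $K$ such that $O(n,n+1,\ldots,n+K)$ occurs only at $m=n$ (well defined for all $n$). -}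

module Defs where

open import Data.Nat using (ℕ; zero; suc; _+_; _*_; _∸_; _≤_; _<_; _<?_)
open import Data.Nat.DivMod using (_/_)
open import Data.Nat.Divisibility using (_∣?_)
open import Data.Nat.Primality using (prime?)
open import Data.Integer using (+_)
open import Data.List using (List; []; _∷_; map; filter; upTo)
open import Data.Product using (_×_)
open import Relation.Nullary using (¬_; yes; no)
open import Relation.Binary.PropositionalEquality using (_≡_)
open import Data.Rational.Unnormalised as Q using (ℚᵘ)

data Tree : Set where
  node : List Tree → Tree

-- p-adic valuation v_p(n), with p = q + 2, computed with fuel
-- (fuel n suffices for n ≥ 1 since n / p < n).

val : (fuel q n : ℕ) → ℕ
val zero    q n = 0
val (suc f) q n with suc (suc q) ∣? n
... | yes _ = suc (val f q (n / suc (suc q)))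
... | no  _ = 0

primeExp : ℕ → ℕ → ℕ
primeExp n q with prime? (suc (suc q))
... | yes _ = val n q n
... | no  _ = 0

exponents : ℕ → List ℕ
exponents n = filter (λ a → 0 <? a) (map (primeExp n) (upTo (n ∸ 1)))

-- tree with fuel (exponents of n are < n, so fuel n suffices for n ≥ 1)
treeF : ℕ → ℕ → Tree
treeF zero    n = node []
treeF (suc f) n = node (map (treeF f) (exponents n))

t : ℕ → Tree
t n = treeF n n

Occurs : ℕ → ℕ → ℕ → Set
Occurs n K m = ∀ j → j ≤ K → t (m + j) ≡ t (n + j)

OccursOnlyAt : ℕ → ℕ → Set
OccursOnlyAt n K = ∀ m → 1 ≤ m → Occurs n K m → m ≡ n

IsKappa : ℕ → ℕ → Set
IsKappa n k = OccursOnlyAt n k × (∀ j → j < k → ¬ OccursOnlyAt n j)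

expTerm : ℚᵘ → ℕ → ℚᵘ
expTerm q zero    = Q.1ℚᵘ
expTerm q (suc i) = expTerm q i Q.* (q Q.* (+ 1 Q./ suc i))

expPartial : ℚᵘ → ℕ → ℚᵘ
expPartial q zero    = Q.0ℚᵘ
expPartial q (suc M) = expPartial q M Q.+ expTerm q M

-- For rational q ≥ 0 and n ≥ 1:  q ≤ log n  ⇔  e^q ≤ n  ⇔  every partial
-- sum of the (nonnegative) exponential series at q is ≤ n.
_≤log_ : ℚᵘ → ℕ → Set
q ≤log n = ∀ M → expPartial q M Q.≤ (+ n Q./ 1)

{-# OPTIONS --safe #-}

-- In fact κ₊(n) = O(n).  Suppose t(m + i) = t(n + i) for
-- all i ≤ 2¹¹ 2ᵃ, where n ≤ 2ᵃ ≤ 2n.  For even x the leftmost subtree of t(x) is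
-- t(v₂(x)).  If the gap m - n were 2ᵉ times an odd number with 1 ≤ e ≤ a, then for
-- each u = e+1, …, e+10 some i in the window would have v₂(m + i) = u and v₂(n + i) = e
-- (or with m, n exchanged), so t(u) = t(e); among these u are one ≡ 4 mod 8 and one
-- ≡ 2 mod 4, whose leftmost subtrees t(2) ≠ t(1) differ.  An odd gap is excluded by
-- matching a number ≡ 4 mod 8 with an odd number ≡ 3 mod 9.  Hence 2ᵃ⁺¹ divides m - n;
-- at the position of 2ᵃ the other number is an odd multiple of 2ᵃ with a single
-- prime factor, so it is 2ᵃ itself.  Finally 2¹² n ≤ 2 n log n
-- as soon as n ≥ e²⁰⁴⁸.
module Submission where

open import Defs
open import Data.Nat using (ℕ; zero; suc; _+_; _*_; _∸_; _^_; _≤_; _<_; _<?_; _≤?_; z≤n; s≤s; >-nonZero)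
open import Data.Nat.Properties
open import Data.Nat.DivMod using (_/_; m*n/n≡m; m/n<m; m≥n⇒m/n>0)
open import Data.Nat.Divisibility
open import Data.Nat.Primality
open import Data.Nat.Primality.Factorisation using (factorise)
open import Data.Nat.Tactic.RingSolver using (solve-∀)
open import Data.Integer as ℤ using (+_; -[1+_])
open import Data.Integer.Properties as ℤ using (pos-*)
open import Data.List using (List; []; _∷_; map; filter; upTo; applyUpTo)
open import Data.List.Properties using (filter-accept; filter-reject; filter-none; ∷-injectiveˡ; ∷-injectiveʳ; map-cong-local)
open import Data.List.Membership.Propositional using (_∈_)
open import Data.List.Membership.Propositional.Properties using (∈-map⁺; ∈-map⁻; ∈-filter⁺; ∈-filter⁻; ∈-applyUpTo⁺; ∈-applyUpTo⁻)
open import Data.List.Relation.Unary.All as All using (All)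
open import Data.Product using (∃; ∃-syntax; _×_; _,_; proj₁; proj₂)
open import Data.Rational.Unnormalised as Q using (mkℚᵘ; 0ℚᵘ; 1ℚᵘ; *≤*; nonNegative)
open import Data.Rational.Unnormalised.Properties as Q using ()
open import Data.Sum using (_⊎_; inj₁; inj₂)
open import Function using (_∘_)
open import Relation.Nullary using (¬_; yes; no; contradiction)
open import Relation.Nullary.Decidable using (from-yes; from-no)
open import Relation.Binary.PropositionalEquality using (_≡_; _≢_; refl; sym; trans; cong; cong₂; subst; module ≡-Reasoning)

+-exchangeʳ : ∀ m n o → m + n + o ≡ m + o + n
+-exchangeʳ = solve-∀

-- Exact prime powers and sufficient fuel.

m<[2+q]^m : ∀ q m → m < suc (suc q) ^ m
m<[2+q]^m q zero    = s≤s z≤n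
m<[2+q]^m q (suc m) = begin
  suc (suc m)               ≤⟨ +-monoʳ-≤ 1 (m<[2+q]^m q m) ⟩
  1 + p^m                   ≤⟨ +-monoˡ-≤ p^m (≤-trans (s≤s z≤n) (m<[2+q]^m q m)) ⟩
  p^m + p^m                 ≤⟨ +-monoʳ-≤ p^m (m≤m+n p^m (q * p^m)) ⟩
  p^m + (p^m + q * p^m)     ∎
  where
  open ≤-Reasoning
  p^m = suc (suc q) ^ m

-- Each division by p = q + 2 spends one unit of fuel, so v units suffice; if they run out exactly
-- then, the default 0 is right because p does not divide c.
val-exact : ∀ f q v c → ¬ (suc (suc q) ∣ c) → v ≤ f → val f q (suc (suc q) ^ v * c) ≡ v
val-exact zero    q zero    c p∤c _ = refl
val-exact (suc f) q zero    c p∤c _ with suc (suc q) ∣? (1 * c)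
... | yes p∣c = contradiction (subst (suc (suc q) ∣_) (*-identityˡ c) p∣c) p∤c
... | no  _   = refl
val-exact (suc f) q (suc v) c p∤c (s≤s v≤f)
  with suc (suc q) ∣? (suc (suc q) * suc (suc q) ^ v * c)
... | no  p∤n = contradiction (∣m⇒∣m*n c (m∣m*n (suc (suc q) ^ v))) p∤n
... | yes _   = cong suc (trans (cong (val f q) quot) (val-exact f q v c p∤c v≤f))
  where
  p = suc (suc q)
  quot : p * p ^ v * c / p ≡ p ^ v * c
  quot = trans (cong (_/ p) (trans (*-assoc p (p ^ v) c) (*-comm p (p ^ v * c)))) (m*n/n≡m (p ^ v * c) p)

val-pos : ∀ f q n → suc (suc q) ∣ n → 0 < f → 0 < val f q n
val-pos (suc f) q n p∣n _ with suc (suc q) ∣? n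
... | yes _  = s≤s z≤n
... | no p∤n = contradiction p∣n p∤n

val-zero : ∀ f q n → ¬ (suc (suc q) ∣ n) → val f q n ≡ 0
val-zero zero    q n _ = refl
val-zero (suc f) q n p∤n with suc (suc q) ∣? n
... | yes p∣n = contradiction p∣n p∤n
... | no _    = refl

val<n : ∀ f q n → 0 < n → val f q n < n
val<n zero    q n 0<n = 0<n
val<n (suc f) q n@(suc _) 0<n with suc (suc q) ∣? n
... | no  _   = 0<n
... | yes p∣n = ≤-<-trans (val<n f q (n / p) (m≥n⇒m/n>0 (∣⇒≤ p∣n))) (m/n<m n p (s≤s (s≤s z≤n)))
  where p = suc (suc q)

primeExp-prime : ∀ n q → Prime (suc (suc q)) → primeExp n q ≡ val n q n
primeExp-prime n q pr with prime? (suc (suc q))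
... | yes _  = refl
... | no ¬pr = contradiction pr ¬pr

primeExp-exact : ∀ q v c → Prime (suc (suc q)) → ¬ (suc (suc q) ∣ c) → primeExp (suc (suc q) ^ v * c) q ≡ v
primeExp-exact q v zero    pr p∤c = contradiction (_ ∣0) p∤c
primeExp-exact q v c@(suc _) pr p∤c =
  trans (primeExp-prime _ q pr) (val-exact _ q v c p∤c (≤-trans (<⇒≤ (m<[2+q]^m q v)) (m≤m*n _ c)))

primeExp-pos : ∀ n q → 0 < n → Prime (suc (suc q)) → suc (suc q) ∣ n → 0 < primeExp n q
primeExp-pos n q 0<n pr p∣n = subst (0 <_) (sym (primeExp-prime n q pr)) (val-pos n q n p∣n 0<n)

primeExp-zero : ∀ n q → (Prime (suc (suc q)) → ¬ (suc (suc q) ∣ n)) → primeExp n q ≡ 0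
primeExp-zero n q p∤n with prime? (suc (suc q))
... | yes pr = val-zero n q n (p∤n pr)
... | no _   = refl

primeExp<n : ∀ n q → 0 < n → primeExp n q < n
primeExp<n n q 0<n with prime? (suc (suc q))
... | yes _ = val<n n q n 0<n
... | no _  = 0<n

-- The recursion for trees, freed of fuel.

∈exponents⇒< : ∀ n {a} → a ∈ exponents n → a < n
∈exponents⇒< (suc n) a∈ with ∈-map⁻ (primeExp (suc n)) (proj₁ (∈-filter⁻ (0 <?_) {xs = map (primeExp (suc n)) (upTo n)} a∈))
... | q , _ , refl = primeExp<n (suc n) q (s≤s z≤n)

-- Exponents of n are below n, so each level needs one unit of fuel less. At n = 0 there are no
-- exponents, which matches the tree of exhausted fuel.
treeF-fuel : ∀ f g n → n ≤ f → n ≤ g → treeF f n ≡ treeF g n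
treeF-fuel zero    zero    n       _ _ = refl
treeF-fuel zero    (suc g) zero    _ _ = refl
treeF-fuel (suc f) zero    zero    _ _ = refl
treeF-fuel (suc f) (suc g) n n≤f n≤g = cong node (map-cong-local (All.tabulate λ {a} a∈ →
  let a<n = ∈exponents⇒< n a∈ in
  treeF-fuel f g a (≤-pred (≤-trans a<n n≤f)) (≤-pred (≤-trans a<n n≤g))))

t-unfold : ∀ n → t n ≡ node (map t (exponents n))
t-unfold zero    = refl
t-unfold (suc n) = cong node (map-cong-local (All.tabulate λ {a} a∈ →
  treeF-fuel n a a (≤-pred (∈exponents⇒< (suc n) a∈)) ≤-refl))

node-injective : ∀ {xs ys} → node xs ≡ node ys → xs ≡ ys
node-injective refl = refl

t≡⇒children≡ : ∀ {m n} → t m ≡ t n → map t (exponents m) ≡ map t (exponents n)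
t≡⇒children≡ {m} {n} eq = node-injective (trans (sym (t-unfold m)) (trans eq (t-unfold n)))

t2≢t1 : t 2 ≢ t 1
t2≢t1 ()

-- First exponents and exponents at odd primes.

prime[3] : Prime 3
prime[3] = from-yes (prime? 3)

-- Exponents at the odd primes: index q stands for q + 2, and the range of `exponents` loses its
-- index 0, hence `n ∸ 2`.
oddExponents : ℕ → List ℕ
oddExponents n = filter (0 <?_) (map (primeExp n) (applyUpTo suc (n ∸ 2)))

2∤1+2* : ∀ c → ¬ (2 ∣ 1 + 2 * c)
2∤1+2* c 2∣ = from-no (2 ∣? 1) (∣m+n∣m⇒∣n (subst (2 ∣_) (+-comm 1 (2 * c)) 2∣) (m∣m*n c))

3∤1+3* : ∀ c → ¬ (3 ∣ 1 + 3 * c)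
3∤1+3* c 3∣ = from-no (3 ∣? 1) (∣m+n∣m⇒∣n (subst (3 ∣_) (+-comm 1 (3 * c)) 3∣) (m∣m*n c))

-- 2 is the least prime, so its positive exponent heads the list and gives the leftmost subtree.
exponents-2^v : ∀ v c → 0 < v → exponents (2 ^ v * (1 + 2 * c)) ≡ v ∷ oddExponents (2 ^ v * (1 + 2 * c))
exponents-2^v v c 0<v = go (2 ^ v * (1 + 2 * c)) 2≤n (primeExp-exact 0 v (1 + 2 * c) prime[2] (2∤1+2* c))
  where
  2≤n : 2 ≤ 2 ^ v * (1 + 2 * c)
  2≤n = ≤-trans (s≤s 0<v) (≤-trans (m<[2+q]^m 0 v) (m≤m*n _ (1 + 2 * c)))
  -- With a variable in place of the product, matching on `suc (suc k)` exposes the first entry.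
  go : ∀ n → 2 ≤ n → primeExp n 0 ≡ v → exponents n ≡ v ∷ oddExponents n
  go (suc zero) (s≤s ())
  go n@(suc (suc k)) _ eq =
    trans (filter-accept (0 <?_) (subst (0 <_) (sym eq) 0<v)) (cong (_∷ oddExponents n) eq)

-- The zero exponent of 2 is filtered out, so the exponent of 3, exactly 1, comes first.
exponents-odd-3 : ∀ n c d → n ≡ 1 + 2 * c → n ≡ 3 * (1 + 3 * d) → ∃[ xs ] exponents n ≡ 1 ∷ xs
exponents-odd-3 n c d n≡odd n≡3 = go n 3≤n (primeExp-zero n 0 (λ _ → 2∤n))
  (subst (λ z → primeExp z 1 ≡ 1) (sym n≡3) (primeExp-exact 1 1 (1 + 3 * d) prime[3] (3∤1+3* d)))
  where
  2∤n : ¬ (2 ∣ n)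
  2∤n = 2∤1+2* c ∘ subst (2 ∣_) n≡odd
  3≤n : 3 ≤ n
  3≤n = subst (3 ≤_) (sym n≡3) (m≤m*n 3 (1 + 3 * d))
  go : ∀ n → 3 ≤ n → primeExp n 0 ≡ 0 → primeExp n 1 ≡ 1 → ∃[ xs ] exponents n ≡ 1 ∷ xs
  go (suc zero) (s≤s ())
  go (suc (suc zero)) (s≤s (s≤s ()))
  go n@(suc (suc (suc k))) _ eq₀ eq₁ = rest , (begin
    exponents n                ≡⟨ filter-reject (0 <?_) (λ 0<e → <-irrefl (sym eq₀) 0<e) ⟩
    filter (0 <?_) (primeExp n 1 ∷ map (primeExp n) (applyUpTo (suc ∘ suc) k))
                               ≡⟨ filter-accept (0 <?_) (subst (0 <_) (sym eq₁) (s≤s z≤n)) ⟩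
    primeExp n 1 ∷ rest        ≡⟨ cong (_∷ rest) eq₁ ⟩
    1 ∷ rest                   ∎)
    where
    open ≡-Reasoning
    rest = filter (0 <?_) (map (primeExp n) (applyUpTo (suc ∘ suc) k))

-- By Euclid's lemma a prime divisor of 2^a divides 2, while this list starts at 3.
oddExponents-2^ : ∀ a → oddExponents (2 ^ a) ≡ []
oddExponents-2^ a = filter-none (0 <?_) (All.tabulate λ e∈ 0<e → not-pos e∈ 0<e)
  where
  prime∣2^⇒∣2 : ∀ {p} → Prime p → ∀ a → p ∣ 2 ^ a → p ∣ 2
  prime∣2^⇒∣2 pr zero    p∣ = ∣-trans p∣ (1∣ 2)
  prime∣2^⇒∣2 pr (suc a) p∣ with euclidsLemma 2 (2 ^ a) pr p∣
  ... | inj₁ p∣2 = p∣2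
  ... | inj₂ p∣  = prime∣2^⇒∣2 pr a p∣
  not-pos : ∀ {e} → e ∈ map (primeExp (2 ^ a)) (applyUpTo suc (2 ^ a ∸ 2)) → ¬ 0 < e
  not-pos e∈ 0<e with ∈-map⁻ (primeExp (2 ^ a)) e∈
  ... | q , q∈ , refl with ∈-applyUpTo⁻ suc q∈
  ... | i , _ , refl = <-irrefl (sym (primeExp-zero (2 ^ a) (suc i) λ pr p∣ →
    <⇒≱ (s≤s (s≤s (s≤s z≤n))) (∣⇒≤ (prime∣2^⇒∣2 pr a p∣)))) 0<e

primeDivisor : ∀ n → 2 ≤ n → ∃[ p ] Prime p × p ∣ n
primeDivisor n@(suc _) 2≤n with factorise n
... | record { factors = [] ; isFactorisation = eq } = contradiction (subst (2 ≤_) eq 2≤n) λ { (s≤s ()) }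
... | record { factors = p ∷ ps ; isFactorisation = eq ; factorsPrime = pr All.∷ _ } =
  p , pr , subst (p ∣_) (sym eq) (m∣m*n _)

oddExponents-nonempty : ∀ n c → 0 < n → 0 < c → 1 + 2 * c ∣ n → oddExponents n ≢ []
oddExponents-nonempty n c 0<n 0<c odd∣n eq with primeDivisor (1 + 2 * c) (s≤s (≤-trans 0<c (m≤m+n c _)))
... | 0 , pr , _ = ¬prime[0] pr
... | 1 , pr , _ = ¬prime[1] pr
... | 2 , _ , 2∣ = 2∤1+2* c 2∣
... | suc (suc (suc q)) , pr , p∣c = nonempty (subst (primeExp n (suc q) ∈_) eq (∈-filter⁺ (0 <?_)
    -- The prime q + 3 ≤ n has index q + 1 ≤ n ∸ 2, within the range of the list.
    (∈-map⁺ (primeExp n) (∈-applyUpTo⁺ suc (∸-monoˡ-≤ 2 (∣⇒≤ {{>-nonZero 0<n}} p∣n))))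
    (primeExp-pos n (suc q) 0<n pr p∣n)))
  where
  p∣n = ∣-trans p∣c odd∣n
  nonempty : ∀ {x : ℕ} → ¬ (x ∈ [])
  nonempty ()


-- Reading exponents off equal trees.

t≡⇒t-2-exponents≡ : ∀ {x y} v w c d → 0 < v → 0 < w → x ≡ 2 ^ v * (1 + 2 * c) → y ≡ 2 ^ w * (1 + 2 * d) →
  t x ≡ t y → t v ≡ t w
t≡⇒t-2-exponents≡ v w c d 0<v 0<w refl refl tx≡ty = ∷-injectiveˡ
  (trans (cong (map t) (sym (exponents-2^v v c 0<v)))
    (trans (t≡⇒children≡ tx≡ty) (cong (map t) (exponents-2^v w d 0<w))))

-- An odd prime factor of 1 + 2c yields a second child, whereas the root for 2^a has only one.
t[2^a*odd]≢t[2^a] : ∀ a c → 0 < a → 0 < c → t (2 ^ a * (1 + 2 * c)) ≢ t (2 ^ a)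
t[2^a*odd]≢t[2^a] a c 0<a 0<c eq = oddExponents-nonempty M c 0<M 0<c (n∣m*n (2 ^ a)) (map≡[] tails≡)
  where
  M = 2 ^ a * (1 + 2 * c)
  0<M : 0 < M
  0<M = ≤-trans (≤-<-trans z≤n (m<[2+q]^m 0 a)) (m≤m*n (2 ^ a) (1 + 2 * c))
  exps : exponents (2 ^ a) ≡ a ∷ []
  exps = begin
    exponents (2 ^ a)              ≡⟨ cong exponents (*-identityʳ (2 ^ a)) ⟨
    exponents (2 ^ a * 1)          ≡⟨ exponents-2^v a 0 0<a ⟩
    a ∷ oddExponents (2 ^ a * 1)   ≡⟨ cong (λ z → a ∷ oddExponents z) (*-identityʳ (2 ^ a)) ⟩
    a ∷ oddExponents (2 ^ a)       ≡⟨ cong (a ∷_) (oddExponents-2^ a) ⟩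
    a ∷ []                         ∎
    where open ≡-Reasoning
  tails≡ : map t (oddExponents M) ≡ []
  tails≡ = ∷-injectiveʳ (trans (cong (map t) (sym (exponents-2^v a c 0<a)))
    (trans (t≡⇒children≡ eq) (cong (map t) exps)))
  map≡[] : ∀ {es} → map t es ≡ [] → es ≡ []
  map≡[] {[]} _ = refl

-- Gaps compatible with agreement on a window.

Agree : ℕ → ℕ → ℕ → Set
Agree x y K = ∀ i → i ≤ K → t (x + i) ≡ t (y + i)

hitResidue : ∀ N r x → r < N → ∃[ i ] ∃[ c ] i < N × x + i ≡ r + N * c
hitResidue N r zero r<N = r , 0 , r<N , sym (trans (cong (λ z → r + z) (*-zeroʳ N)) (+-identityʳ r))
hitResidue (suc N) r (suc x) r<N with hitResidue (suc N) r x r<N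
... | suc i , c , i<N , eq = i , c , <-trans (n<1+n i) i<N , trans (sym (+-suc x i)) eq
-- A hit at the old start leaves the window; the next member of the class, one period later, is its
-- new last entry.
... | zero  , c , _   , eq = N , suc c , n<1+n N , (begin
  suc x + N                 ≡⟨ shift x N ⟩
  (x + 0) + suc N           ≡⟨ cong (_+ suc N) eq ⟩
  (r + suc N * c) + suc N   ≡⟨ next r N c ⟩
  r + suc N * suc c         ∎)
  where
  open ≡-Reasoning
  shift : ∀ x N → suc x + N ≡ (x + 0) + suc N
  shift = solve-∀
  next : ∀ r N c → (r + suc N * c) + suc N ≡ r + suc N * suc c
  next = solve-∀

-- x + i ≡ 4 (mod 8) has first child t 2, and y + i ≡ 3 (mod 9) is odd with first child t 1;
-- the shift 64 l leaves the former congruence alone and moves y + i through all residues mod 9.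
¬Agree-odd-gap : ∀ x d K → 519 ≤ K → ¬ Agree x (x + (1 + 2 * d)) K
¬Agree-odd-gap x d K 519≤K agree =
  let y = x + (1 + 2 * d)
      i₀ , c , i₀<8 , eq₀ = hitResidue 8 4 x (from-yes (4 <? 8))
      l , b , l<9 , eq₁   = hitResidue 9 3 (y + i₀) (from-yes (3 <? 9))
      i = i₀ + 64 * l
      -- i₀ ≤ 7 and l ≤ 8 give i ≤ 7 + 64 * 8 = 519.
      i≤K = ≤-trans (+-mono-≤ (≤-pred i₀<8) (*-monoʳ-≤ 64 (≤-pred l<9))) 519≤K
      x+i≡ = trans (sym (+-assoc x i₀ (64 * l))) (trans (cong (_+ 64 * l) eq₀) (four c l))
      y+i-odd = trans (odd₁ x d i₀ l) (trans (cong (_+ (1 + 2 * d + 64 * l)) eq₀) (odd₂ c d l))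
      y+i≡ = trans (three₁ x d i₀ l) (trans (cong (_+ 63 * l) eq₁) (three₂ b l))
      rest , exps = exponents-odd-3 (y + i) (2 + 4 * c + 32 * l + d) (b + 7 * l) y+i-odd y+i≡
      exps₂ = trans (cong exponents x+i≡) (exponents-2^v 2 (c + 8 * l) (s≤s z≤n))
  in t2≢t1 (∷-injectiveˡ
       (trans (cong (map t) (sym exps₂)) (trans (t≡⇒children≡ (agree i i≤K)) (cong (map t) exps))))
  where
  odd₁ : ∀ x d i l → x + (1 + 2 * d) + (i + 64 * l) ≡ (x + i) + (1 + 2 * d + 64 * l)
  odd₁ = solve-∀
  odd₂ : ∀ c d l → 4 + 8 * c + (1 + 2 * d + 64 * l) ≡ 1 + 2 * (2 + 4 * c + 32 * l + d)
  odd₂ = solve-∀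
  three₁ : ∀ x d i l → x + (1 + 2 * d) + (i + 64 * l) ≡ x + (1 + 2 * d) + i + l + 63 * l
  three₁ = solve-∀
  three₂ : ∀ b l → 3 + 9 * b + 63 * l ≡ 3 * (1 + 3 * (b + 7 * l))
  three₂ = solve-∀
  four : ∀ c l → 4 + 8 * c + 64 * l ≡ 2 ^ 2 * (1 + 2 * (c + 8 * l))
  four = solve-∀

-- If x + i is an odd multiple of 2^u with u > e, adding the gap leaves the 2-exponent exactly e, so
-- t u = t e. Two such u, congruent to 4 and 6 mod 8, then force t 2 = t 1.
¬Agree-2^e*odd-gap : ∀ e x d K → 0 < e → 2 ^ (e + 11) ≤ K → ¬ Agree x (x + 2 ^ e * (1 + 2 * d)) K
¬Agree-2^e*odd-gap e x d K 0<e 2^≤K agree =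
  -- Some s ≤ 7 reaches 4 mod 8 from e + 1, and s + 2 ≤ 9 reaches 6 mod 8; so only u ≤ e + 10 occur.
  let s , c , s<8 , eq = hitResidue 8 4 (e + 1) (from-yes (4 <? 8))
      t₄ = t-shift s (≤-trans (≤-pred s<8) (from-yes (7 ≤? 9)))
      t₆ = t-shift (s + 2) (+-monoˡ-≤ 2 (≤-pred s<8))
      six = trans (sym (+-assoc (e + 1) s 2)) (trans (cong (_+ 2) eq) (six′ c))
  in t2≢t1 (t≡⇒t-2-exponents≡ 2 1 c (1 + 2 * c) (s≤s z≤n) (s≤s z≤n)
       (trans eq (four c)) six (trans t₄ (sym t₆)))
  where
  four : ∀ c → 4 + 8 * c ≡ 2 ^ 2 * (1 + 2 * c)
  four = solve-∀
  six′ : ∀ c → 4 + 8 * c + 2 ≡ 2 ^ 1 * (1 + 2 * (1 + 2 * c))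
  six′ = solve-∀
  factor : ∀ p c → p + 2 * p * c ≡ p * (1 + 2 * c)
  factor = solve-∀
  regroup : ∀ p q c d → p * 2 * q * (1 + 2 * c) + p * (1 + 2 * d) ≡ p * (1 + 2 * (d + q * (1 + 2 * c)))
  regroup = solve-∀
  e+2+s≡ : ∀ e s → e + (2 + s) ≡ suc (e + 1 + s)
  e+2+s≡ = solve-∀
  t-shift : ∀ s → s ≤ 9 → t (e + 1 + s) ≡ t e
  t-shift s s≤9 =
    let u = e + 1 + s
        2^u = 2 ^ u
        -- Residue 2^u modulo 2^(u+1) means 2-exponent exactly u; the period is at most 2^(e+11), so
        -- a hit lies in the window.
        i , c , i<N , eq = hitResidue (2 ^ suc u) 2^u x (^-monoʳ-< 2 (s≤s (s≤s z≤n)) (n<1+n u))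
        u<e+11 = subst (_≤ e + 11) (e+2+s≡ e s) (+-monoʳ-≤ e (+-monoʳ-≤ 2 s≤9))
        i≤K = ≤-trans (<⇒≤ i<N) (≤-trans (^-monoʳ-≤ 2 u<e+11) 2^≤K)
        x+i≡ = trans eq (factor 2^u c)
        split = trans (^-distribˡ-+-* 2 (e + 1) s) (cong (_* 2 ^ s) (^-distribˡ-+-* 2 e 1))
        y+i≡ = trans (+-exchangeʳ x (2 ^ e * (1 + 2 * d)) i)
          (trans (cong (_+ 2 ^ e * (1 + 2 * d)) (trans x+i≡ (cong (_* (1 + 2 * c)) split))) (regroup (2 ^ e) (2 ^ s) c d))
    in t≡⇒t-2-exponents≡ u e c (d + 2 ^ s * (1 + 2 * c)) (≤-trans 0<e (≤-trans (m≤m+n e 1) (m≤m+n (e + 1) s))) 0<e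
         x+i≡ y+i≡ (agree i i≤K)

even⊎odd : ∀ n → ∃[ c ] (n ≡ 2 * c ⊎ n ≡ 1 + 2 * c)
even⊎odd zero = 0 , inj₁ refl
even⊎odd (suc n) with even⊎odd n
... | c , inj₁ n≡ = c , inj₂ (cong suc n≡)
... | c , inj₂ n≡ = suc c , inj₁ (trans (cong suc n≡) (sym (*-suc 2 c)))

-- Induction on e: in D = q * 2^e an odd q is excluded for every e ≤ a, so q is even and one more
-- factor 2 splits off, up to 2^(a+1).
Agree⇒2^∣gap : ∀ a x D → Agree x (x + D) (2 ^ a * 2 ^ 11) → ∀ e → e ≤ suc a → 2 ^ e ∣ D
Agree⇒2^∣gap a x D agree zero    _ = 1∣ D
Agree⇒2^∣gap a x D agree (suc e) (s≤s e≤a) with Agree⇒2^∣gap a x D agree e (m≤n⇒m≤1+n e≤a)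
... | divides q D≡ with even⊎odd q
... | c , inj₁ refl = divides c (trans D≡ (regroup c (2 ^ e)))
  where
  regroup : ∀ c p → 2 * c * p ≡ c * (2 * p)
  regroup = solve-∀
Agree⇒2^∣gap a x D agree (suc zero) _ | divides q D≡ | c , inj₂ refl =
  contradiction (subst (λ z → Agree x (x + z) _) (trans D≡ (*-identityʳ q)) agree)
    (¬Agree-odd-gap x c _ (≤-trans (from-yes (519 ≤? 2 ^ 11)) (m≤n*m (2 ^ 11) (2 ^ a) {{m^n≢0 2 a}})))
Agree⇒2^∣gap a x D agree (suc e@(suc _)) (s≤s e≤a) | divides q D≡ | c , inj₂ refl =
  contradiction (subst (λ z → Agree x (x + z) _) (trans D≡ (*-comm q (2 ^ e))) agree)
    (¬Agree-2^e*odd-gap e x c _ (s≤s z≤n)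
      (subst (_≤ 2 ^ a * 2 ^ 11) (sym (^-distribˡ-+-* 2 e 11)) (*-monoˡ-≤ (2 ^ 11) (^-monoʳ-≤ 2 e≤a))))

-- Uniqueness of the occurrence and a linear bound.

-- For m ≤ n the gap is at most n < 2^(a+1), so divisibility makes it 0. For m > n it has no such
-- bound, and the trees at the position of 2^a decide.
occursOnlyAt : ∀ n a → 2 ≤ n → n ≤ 2 ^ a → OccursOnlyAt n (2 ^ a * 2 ^ 11)
occursOnlyAt n a 2≤n n≤2^a m 1≤m occurs with ≤-total m n
... | inj₁ m≤n = trans (sym (+-identityʳ m)) (trans (cong (λ z → m + z) (sym D≡0)) m+D≡n)
  where
  D = n ∸ m
  m+D≡n : m + D ≡ n
  m+D≡n = m+[n∸m]≡n m≤n
  2^∣D : 2 ^ suc a ∣ D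
  2^∣D = Agree⇒2^∣gap a m D (λ i i≤K → subst (λ z → _ ≡ t (z + i)) (sym m+D≡n) (occurs i i≤K)) (suc a) ≤-refl
  D<2^ : D < 2 ^ suc a
  D<2^ = ≤-<-trans (≤-trans (m∸n≤m n m) n≤2^a) (^-monoʳ-< 2 (s≤s (s≤s z≤n)) (n<1+n a))
  D≡0 : D ≡ 0
  D≡0 with D | 2^∣D | D<2^
  ... | zero  | _  | _  = refl
  ... | suc _ | d∣ | d< = contradiction (∣⇒≤ d∣) (<⇒≱ d<)
... | inj₂ n≤m with Agree⇒2^∣gap a n (m ∸ n)
                      (λ i i≤K → subst (λ z → _ ≡ t (z + i)) (sym (m+[n∸m]≡n n≤m)) (sym (occurs i i≤K))) (suc a) ≤-refl
... | divides zero D≡0 = ≤-antisym (m∸n≡0⇒m≤n D≡0) n≤m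
... | divides d@(suc _) D≡ = contradiction
    (trans (cong t (sym m+j≡)) (trans (occurs j j≤K) (cong t (m+[n∸m]≡n n≤2^a))))
    -- `2 ≤ n` makes a positive, so that 2 contributes a child on both sides.
    (t[2^a*odd]≢t[2^a] a d (0<exponent a (≤-trans 2≤n n≤2^a)) (s≤s z≤n))
  where
  j = 2 ^ a ∸ n
  j≤K : j ≤ 2 ^ a * 2 ^ 11
  j≤K = ≤-trans (m∸n≤m (2 ^ a) n) (m≤m*n (2 ^ a) (2 ^ 11))
  0<exponent : ∀ a → 2 ≤ 2 ^ a → 0 < a
  0<exponent zero (s≤s ())
  0<exponent (suc a) _ = s≤s z≤n
  factor : ∀ p d → p + d * (2 * p) ≡ p * (1 + 2 * d)
  factor = solve-∀
  m+j≡ : m + j ≡ 2 ^ a * (1 + 2 * d)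
  m+j≡ = begin
    m + j                      ≡⟨ cong (_+ j) (m+[n∸m]≡n n≤m) ⟨
    n + (m ∸ n) + j            ≡⟨ +-exchangeʳ n (m ∸ n) j ⟩
    n + j + (m ∸ n)            ≡⟨ cong₂ _+_ (m+[n∸m]≡n n≤2^a) D≡ ⟩
    2 ^ a + d * (2 * 2 ^ a)    ≡⟨ factor (2 ^ a) d ⟩
    2 ^ a * (1 + 2 * d)        ∎
    where open ≡-Reasoning

powerOf2-above : ∀ n → 1 ≤ n → ∃[ a ] n ≤ 2 ^ a × 2 ^ a ≤ 2 * n
powerOf2-above (suc zero)    _ = 0 , ≤-refl , s≤s z≤n
powerOf2-above (suc n@(suc _)) _ with powerOf2-above n (s≤s z≤n)
... | a , n≤ , ≤2n with suc n ≤? 2 ^ a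
... | yes n< = a , n< , ≤-trans ≤2n (*-monoʳ-≤ 2 (n≤1+n n))
... | no  n≮ = suc a , ≤-trans (m<m+n n (s≤s z≤n)) (*-monoʳ-≤ 2 n≤) , *-monoʳ-≤ 2 (≤-trans (≤-pred (≰⇒> n≮)) (n≤1+n n))

IsKappa⇒≤ : ∀ n k → 2 ≤ n → IsKappa n k → k ≤ 2 ^ 12 * n
IsKappa⇒≤ n k 2≤n (_ , minimal) with powerOf2-above n (≤-trans (s≤s z≤n) 2≤n)
... | a , n≤2^a , 2^a≤2n = ≤-trans (≮⇒≥ λ K<k → minimal _ K<k (occursOnlyAt n a 2≤n n≤2^a))
  -- Rounding n up to a power of two costs a factor 2, whence 2^12.
  (≤-trans (*-monoˡ-≤ (2 ^ 11) 2^a≤2n) (≤-reflexive (regroup n)))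
  where
  regroup : ∀ n → 2 * n * 2 ^ 11 ≡ 2 ^ 12 * n
  regroup = solve-∀

-- Bounding the exponential series.

expTerm-nonNeg : ∀ q → 0ℚᵘ Q.≤ q → ∀ i → 0ℚᵘ Q.≤ expTerm q i
expTerm-nonNeg q 0≤q zero    = *≤* (ℤ.+≤+ z≤n)
expTerm-nonNeg q 0≤q (suc i) = Q.nonNegative⁻¹ _
  {{Q.nonNeg*nonNeg⇒nonNeg (expTerm q i) {{nonNegative (expTerm-nonNeg q 0≤q i)}} (q Q.* (+ 1 Q./ suc i))
    {{Q.nonNeg*nonNeg⇒nonNeg q {{nonNegative 0≤q}} (+ 1 Q./ suc i)}}}}

expTerm-mono : ∀ {q r} → 0ℚᵘ Q.≤ q → q Q.≤ r → ∀ i → expTerm q i Q.≤ expTerm r i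
expTerm-mono 0≤q q≤r zero = Q.≤-refl
expTerm-mono {q} {r} 0≤q q≤r (suc i) = Q.*-mono-≤-nonNeg
  {{nonNegative (expTerm-nonNeg q 0≤q i)}} {{Q.nonNeg*nonNeg⇒nonNeg q {{nonNegative 0≤q}} 1/}}
  (expTerm-mono 0≤q q≤r i) (Q.*-monoˡ-≤-nonNeg 1/ q≤r)
  where 1/ = + 1 Q./ suc i

expPartial-mono : ∀ {q r} → 0ℚᵘ Q.≤ q → q Q.≤ r → ∀ M → expPartial q M Q.≤ expPartial r M
expPartial-mono 0≤q q≤r zero    = Q.≤-refl
expPartial-mono 0≤q q≤r (suc M) = Q.+-mono-≤ (expPartial-mono 0≤q q≤r M) (expTerm-mono 0≤q q≤r M)

expPartial-≤ : ∀ q → 0ℚᵘ Q.≤ q → ∀ M k → expPartial q M Q.≤ expPartial q (k + M)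
expPartial-≤ q 0≤q M zero    = Q.≤-refl
expPartial-≤ q 0≤q M (suc k) = Q.≤-trans (expPartial-≤ q 0≤q M k)
  (Q.p≤p+q (expPartial q (k + M)) (expTerm q (k + M)) {{nonNegative (expTerm-nonNeg q 0≤q (k + M))}})

-- Denominators are at least 1, so a non-negative fraction is at most its numerator.
ceiling : ∀ q → ∃[ N ] q Q.≤ (+ N Q./ 1)
ceiling (mkℚᵘ (+ n) d)    = n , *≤* (ℤ.*-monoˡ-≤-nonNeg (+ n) (ℤ.+≤+ (s≤s z≤n)))
ceiling (mkℚᵘ -[1+ n ] d) = 0 , *≤* ℤ.-≤+

module _ (c : ℕ) where

  private
    q = + c Q./ 1

  0≤c/1 : 0ℚᵘ Q.≤ q
  0≤c/1 = Q.nonNegative⁻¹ q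

  -- The ratio of consecutive terms is c / (i + 1), here at most 1/2.
  expTerm-halves : ∀ i → 2 * c ≤ suc i → expTerm q (suc i) Q.+ expTerm q (suc i) Q.≤ expTerm q i
  expTerm-halves i 2c≤ = begin
    T Q.* x Q.+ T Q.* x   ≃⟨ Q.*-distribˡ-+ T x x ⟨
    T Q.* (x Q.+ x)       ≤⟨ Q.*-monoʳ-≤-nonNeg T {{nonNegative (expTerm-nonNeg q 0≤c/1 i)}} x+x≤1 ⟩
    T Q.* 1ℚᵘ             ≃⟨ Q.*-identityʳ T ⟩
    T                     ∎
    where
    open Q.≤-Reasoning
    T = expTerm q i
    x = q Q.* (+ 1 Q./ suc i)
    q+q≤ : q Q.+ q Q.≤ (+ suc i Q./ 1)
    q+q≤ = *≤* (ℤ.*-monoʳ-≤-nonNeg (+ 1) (ℤ.≤-trans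
      (ℤ.≤-reflexive (cong₂ ℤ._+_ (ℤ.*-identityʳ (+ c)) (ℤ.*-identityʳ (+ c))))
      (ℤ.+≤+ (subst (λ z → c + z ≤ suc i) (+-identityʳ c) 2c≤))))
    cancel : (+ suc i Q./ 1) Q.* (+ 1 Q./ suc i) Q.≃ 1ℚᵘ
    cancel = Q.*≡* (trans (ℤ.*-identityʳ _) (trans (ℤ.*-identityʳ (+ suc i))
      (sym (trans (ℤ.*-identityˡ _) (cong +_ (*-identityˡ (suc i)))))))
    x+x≤1 : x Q.+ x Q.≤ 1ℚᵘ
    x+x≤1 = begin
      x Q.+ x                                        ≃⟨ Q.*-distribʳ-+ (+ 1 Q./ suc i) q q ⟨
      (q Q.+ q) Q.* (+ 1 Q./ suc i)                  ≤⟨ Q.*-monoˡ-≤-nonNeg (+ 1 Q./ suc i) q+q≤ ⟩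
      (+ suc i Q./ 1) Q.* (+ 1 Q./ suc i)            ≃⟨ cancel ⟩
      1ℚᵘ                                            ∎

  private
    M₀ = 2 * c
    S = expPartial q
    T = expTerm q
    B = S M₀ Q.+ (T M₀ Q.+ T M₀)

  -- S M + 2 T M decreases once consecutive terms at least halve.
  expPartial-tail : ∀ k → S (k + M₀) Q.+ (T (k + M₀) Q.+ T (k + M₀)) Q.≤ B
  expPartial-tail zero    = Q.≤-refl
  expPartial-tail (suc k) = begin
    (S i Q.+ T i) Q.+ (T (suc i) Q.+ T (suc i))  ≤⟨ Q.+-monoʳ-≤ (S i Q.+ T i) (expTerm-halves i (≤-trans (m≤n+m M₀ k) (n≤1+n i))) ⟩
    (S i Q.+ T i) Q.+ T i                        ≃⟨ Q.+-assoc (S i) (T i) (T i) ⟩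
    S i Q.+ (T i Q.+ T i)                        ≤⟨ expPartial-tail k ⟩
    B                                            ∎
    where
    open Q.≤-Reasoning
    i = k + M₀

  expPartial-bounded : ∃[ N ] ∀ M → S M Q.≤ (+ N Q./ 1)
  expPartial-bounded = proj₁ (ceiling B) , λ M → begin
    -- The tail estimate starts at `M₀`, so the index is first raised past it.
    S M                                                     ≤⟨ expPartial-≤ q 0≤c/1 M M₀ ⟩
    S (M₀ + M)                                              ≡⟨ cong S (+-comm M₀ M) ⟩
    S (M + M₀)                                              ≤⟨ Q.p≤p+q (S (M + M₀)) _ {{0≤T+T M}} ⟩
    S (M + M₀) Q.+ (T (M + M₀) Q.+ T (M + M₀))              ≤⟨ expPartial-tail M ⟩
    B                                                       ≤⟨ proj₂ (ceiling B) ⟩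
    + proj₁ (ceiling B) Q./ 1                               ∎
    where
    open Q.≤-Reasoning
    0≤T : ∀ M → Q.NonNegative (T (M + M₀))
    0≤T M = nonNegative (expTerm-nonNeg q 0≤c/1 (M + M₀))
    0≤T+T : ∀ M → Q.NonNegative (T (M + M₀) Q.+ T (M + M₀))
    0≤T+T M = Q.nonNeg+nonNeg⇒nonNeg (T (M + M₀)) {{0≤T M}} (T (M + M₀)) {{0≤T M}}

-- Comparison with the logarithm.

-- k / (2n) ≤ 2^11 and (j + 1) / (j + 2) < 1. `mkℚᵘ` takes the denominator less one, hence `∸ 1`.
ratio-≤ : ∀ n j k → 1 ≤ n → k ≤ 2 ^ 12 * n →
  mkℚᵘ (+ (k * suc j)) (2 * n * (j + 2) ∸ 1) Q.≤ (+ (2 ^ 11) Q./ 1)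
ratio-≤ n@(suc _) j k _ k≤ = *≤* (ℤ.≤-trans (ℤ.≤-reflexive (ℤ.*-identityʳ (+ (k * suc j))))
  (ℤ.≤-trans (ℤ.+≤+ bound) (ℤ.≤-reflexive (pos-* (2 ^ 11) (suc (2 * n * (j + 2) ∸ 1))))))
  where
  regroup : ∀ n j → 2 ^ 12 * n * j ≡ 2 ^ 11 * (2 * n * j)
  regroup = solve-∀
  bound : k * suc j ≤ 2 ^ 11 * suc (2 * n * (j + 2) ∸ 1)
  bound = begin
    k * suc j                                ≤⟨ *-mono-≤ k≤ (subst (_≤ j + 2) (+-comm j 1) (+-monoʳ-≤ j (s≤s z≤n))) ⟩
    2 ^ 12 * n * (j + 2)                     ≡⟨ regroup n (j + 2) ⟩
    2 ^ 11 * (2 * n * (j + 2))               ≤⟨ *-monoʳ-≤ (2 ^ 11) (m≤n+m∸n (2 * n * (j + 2)) 1) ⟩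
    2 ^ 11 * suc (2 * n * (j + 2) ∸ 1)       ∎
    where open ≤-Reasoning

-- N bounds all partial sums at c, hence e^c, and partial sums are monotone in q ≥ 0.
≤log-bounded : ∀ c → ∃[ N ] ∀ q n → 0ℚᵘ Q.≤ q → q Q.≤ (+ c Q./ 1) → N ≤ n → q ≤log n
≤log-bounded c = proj₁ (expPartial-bounded c) , λ q n 0≤q q≤c N≤n M → Q.≤-trans
  (expPartial-mono 0≤q q≤c M)
  (Q.≤-trans (proj₂ (expPartial-bounded c) M) (*≤* (ℤ.*-monoʳ-≤-nonNeg (+ 1) (ℤ.+≤+ N≤n))))

-- The fraction is k(j+1) / (2n(j+2)), so the inequality reads k ≤ 2n log n (1 + 1/(j+1)); having it
-- eventually for every j is the o(1).
theorem2 : ∀ (j : ℕ) → ∃ λ N → ∀ n → 2 ≤ n → N ≤ n → ∀ k → IsKappa n k →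
    mkℚᵘ (+ (k * suc j)) ((2 * n * (j + 2) ∸ 1)) ≤log n
theorem2 j = proj₁ (≤log-bounded (2 ^ 11)) , λ n 2≤n N≤n k κ →
  proj₂ (≤log-bounded (2 ^ 11)) _ n (Q.nonNegative⁻¹ (mkℚᵘ (+ (k * suc j)) _))
    (ratio-≤ n j k (≤-trans (s≤s z≤n) 2≤n) (IsKappa⇒≤ n k 2≤n κ)) N≤n
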